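{- Let $k \geq 2$ be an integer. Then there exist a polynomial $f(X) \in \mathbb{Q}[X]$ of degree $k-1$ and an integer $N_0$ (depending on $f$) such that \[ f(n) < \frac{1}{\sum_{i=n+1}^{\infty} i^{ -k}} < f(n)+1 \] holds for all integers $n \geq N_0$. Moreover, $f$ is unique up to the constant term: any two polynomials in $\mathbb{Q}[X]$ of degree $k-1$ having this property (each with its own integer $N_0$) differ by a constant. -}

module Defs where

open import Data.Integer.Base as ℤ using (+_)
import Data.Integer.Properties as ℤP
import Data.Integer.Solver as ℤSolver
open import Data.List.Base using (List; []; _∷_)
open import Data.Nat.Base as ℕ using (ℕ; zero; suc; z≤n; s≤s)
import Data.Nat.Properties as ℕP
open import Data.Product.Base using (∃; ∃-syntax; _×_; _,_; proj₁; proj₂)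
open import Data.Rational.Base
import Data.Rational.Properties as ℚP
import Data.Rational.Solver as ℚSolver
import Data.Rational.Unnormalised.Base as ℚᵘ
import Data.Rational.Unnormalised.Properties as ℚᵘP
open import Data.Sum.Base using (_⊎_; inj₁; inj₂)
open import Relation.Binary.PropositionalEquality

-- Coefficient lists, constant term first.  Trailing zeros are allowed, so
-- two lists are the same polynomial when they agree under _≋_.

Poly : Set
Poly = List ℚ

coeff : Poly → ℕ → ℚ
coeff []      _       = 0ℚ
coeff (a ∷ f) zero    = a
coeff (a ∷ f) (suc i) = coeff f i

infix 4 _≋_
_≋_ : Poly → Poly → Set
f ≋ g = ∀ i → coeff f i ≡ coeff g i

infixl 6 _⊕_
_⊕_ : Poly → Poly → Poly
[]      ⊕ g       = g
(a ∷ f) ⊕ []      = a ∷ f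
(a ∷ f) ⊕ (b ∷ g) = (a + b) ∷ (f ⊕ g)

constant : ℚ → Poly
constant c = c ∷ []

HasDegree : Poly → ℕ → Set
HasDegree f d = coeff f d ≢ 0ℚ × (∀ i → d ℕ.< i → coeff f i ≡ 0ℚ)

eval : Poly → ℚ → ℚ
eval []      x = 0ℚ
eval (a ∷ f) x = a + x * eval f x

IsCauchy : (ℕ → ℚ) → Set
IsCauchy s = ∀ ε → 0ℚ < ε →
  ∃[ N ] (∀ m n → N ℕ.≤ m → N ℕ.≤ n → ∣ s m - s n ∣ < ε)

record ℝ : Set where
  constructor mkℝ
  field
    seq    : ℕ → ℚ
    cauchy : IsCauchy seq

open ℝ public

-- Strict order of the represented reals: the sequences are eventually
-- separated by a fixed positive rational (so this does not depend on the
-- choice of representatives).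

infix 4 _<ℝ_
_<ℝ_ : ℝ → ℝ → Set
x <ℝ y = ∃[ ε ] (0ℚ < ε × ∃[ N ] (∀ m → N ℕ.≤ m → seq x m + ε ≤ seq y m))

fromℚ : ℚ → ℝ
fromℚ q = mkℝ (λ _ → q) λ ε ε>0 →
  0 , λ _ _ _ _ → subst (λ z → ∣ z ∣ < ε) (sym (ℚP.+-inverseʳ q)) ε>0

0ℝ : ℝ
0ℝ = fromℚ 0ℚ

module _ (x : ℝ) (x>0 : 0ℝ <ℝ x) where

  private
    δ : ℚ
    δ = proj₁ x>0

    M : ℕ
    M = proj₁ (proj₂ (proj₂ x>0))

    instance
      δ-pos : Positive δ
      δ-pos = positive (proj₁ (proj₂ x>0))

      δ-nonNeg : NonNegative δ
      δ-nonNeg = ℚP.pos⇒nonNeg δ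

      δδ-pos : Positive (δ * δ)
      δδ-pos = ℚP.pos*pos⇒pos δ δ

      δδ-nonNeg : NonNegative (δ * δ)
      δδ-nonNeg = ℚP.pos⇒nonNeg (δ * δ)

    s : ℕ → ℚ
    s m = seq x (M ℕ.+ m)

    δ≤s : ∀ m → δ ≤ s m
    δ≤s m = subst (_≤ s m) (ℚP.+-identityˡ δ)
      (proj₂ (proj₂ (proj₂ x>0)) (M ℕ.+ m) (ℕP.m≤m+n M m))

    s-pos : ∀ m → Positive (s m)
    s-pos m = positive (ℚP.<-≤-trans (ℚP.positive⁻¹ δ) (δ≤s m))

    s-nonZero : ∀ m → NonZero (s m)
    s-nonZero m = ℚP.pos⇒nonZero (s m) {{s-pos m}}

  -- The sequence of x is at least δ > 0 from index M on; the reciprocal is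
  -- represented by the termwise reciprocals from there.

  recipSeq : ℕ → ℚ
  recipSeq m = (1/ s m) {{s-nonZero m}}

  private
    key : ∀ m n → (recipSeq m - recipSeq n) * (s m * s n) ≡ s n - s m
    key m n = trans (lemma (recipSeq m) (recipSeq n) (s m) (s n))
      (cong₂ (λ u v → u * s n - v * s m)
        (ℚP.*-inverseˡ (s m) {{s-nonZero m}})
        (ℚP.*-inverseˡ (s n) {{s-nonZero n}})
       ■ cong₂ _-_ (ℚP.*-identityˡ (s n)) (ℚP.*-identityˡ (s m)))
      where
      open ℚSolver.+-*-Solver
      infixr 5 _■_
      _■_ : ∀ {p q r : ℚ} → p ≡ q → q ≡ r → p ≡ r
      _■_ = trans
      lemma : ∀ a b c d → (a - b) * (c * d) ≡ (a * c) * d - (b * d) * c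
      lemma = solve 4
        (λ a b c d → (a :- b) :* (c :* d) := (a :* c) :* d :- (b :* d) :* c) refl

    bound : ∀ m n → ∣ recipSeq m - recipSeq n ∣ * (δ * δ) ≤ ∣ s n - s m ∣
    bound m n = begin
      ∣ d ∣ * (δ * δ)          ≤⟨ ℚP.*-monoˡ-≤-nonNeg ∣ d ∣ {{ℚP.∣-∣-nonNeg d}} δδ≤ ⟩
      ∣ d ∣ * (s m * s n)      ≡⟨ cong (∣ d ∣ *_) (ℚP.0≤p⇒∣p∣≡p 0≤ss) ⟨
      ∣ d ∣ * ∣ s m * s n ∣    ≡⟨ ℚP.∣p*q∣≡∣p∣*∣q∣ d (s m * s n) ⟨
      ∣ d * (s m * s n) ∣      ≡⟨ cong ∣_∣ (key m n) ⟩
      ∣ s n - s m ∣            ∎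
      where
      open ℚP.≤-Reasoning
      d = recipSeq m - recipSeq n
      δδ≤ : δ * δ ≤ s m * s n
      δδ≤ = ℚP.≤-trans (ℚP.*-monoˡ-≤-nonNeg δ (δ≤s n))
        (ℚP.*-monoʳ-≤-nonNeg (s n) {{ℚP.pos⇒nonNeg (s n) {{s-pos n}}}} (δ≤s m))
      0≤ss : 0ℚ ≤ s m * s n
      0≤ss = ℚP.≤-trans (ℚP.nonNegative⁻¹ (δ * δ)) δδ≤

  recip : ℝ
  recip = mkℝ recipSeq λ ε ε>0 →
    let N , close = cauchy x (ε * (δ * δ)) (ε·δδ>0 ε ε>0)
    in N , λ m n N≤m N≤n →
      ℚP.*-cancelʳ-<-nonNeg (δ * δ)
        (ℚP.≤-<-trans (bound m n)
          (close (M ℕ.+ n) (M ℕ.+ m)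
            (ℕP.m≤n⇒m≤o+n M N≤n) (ℕP.m≤n⇒m≤o+n M N≤m)))
    where
    ε·δδ>0 : ∀ ε → 0ℚ < ε → 0ℚ < ε * (δ * δ)
    ε·δδ>0 ε ε>0 = ℚP.positive⁻¹ (ε * (δ * δ))
      {{ℚP.pos*pos⇒pos ε {{positive ε>0}} (δ * δ)}}

partialSum : (ℕ → ℚ) → ℕ → ℚ
partialSum a zero    = 0ℚ
partialSum a (suc m) = partialSum a m + a m

Summable : (ℕ → ℚ) → Set
Summable a = IsCauchy (partialSum a)

∑∞ : (a : ℕ → ℚ) → Summable a → ℝ
∑∞ a conv = mkℝ (partialSum a) conv

invPow : ℕ → (i : ℕ) .{{_ : ℕ.NonZero i}} → ℚ
invPow k i = (+ 1 / (i ℕ.^ k)) {{ℕP.m^n≢0 i k}}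

-- The summand of index i = n + 1 + j.

tailTerm : ℕ → ℕ → ℕ → ℚ
tailTerm k n j = invPow k (suc n ℕ.+ j)

1/-mono : ∀ a b .{{_ : ℕ.NonZero a}} .{{_ : ℕ.NonZero b}} →
          b ℕ.≤ a → + 1 / a ≤ + 1 / b
1/-mono (suc a) (suc b) b≤a = ℚP.toℚᵘ-cancel-≤
  (ℚᵘP.≤-respˡ-≃ (ℚᵘP.≃-sym (ℚP.toℚᵘ-fromℚᵘ (ℚᵘ.mkℚᵘ (+ 1) a)))
  (ℚᵘP.≤-respʳ-≃ (ℚᵘP.≃-sym (ℚP.toℚᵘ-fromℚᵘ (ℚᵘ.mkℚᵘ (+ 1) b)))
    (ℚᵘ.*≤* (ℤP.*-monoˡ-≤-nonNeg (+ 1) (ℤ.+≤+ b≤a)))))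

1/-pos : ∀ a .{{_ : ℕ.NonZero a}} → 0ℚ < + 1 / a
1/-pos a = ℚP.positive⁻¹ (+ 1 / a) {{ℚP.normalize-pos 1 a}}

telescope : ∀ u →
  + 1 / (suc (suc u) ℕ.* suc u) + + 1 / suc (suc u) ≡ + 1 / suc u
telescope u = ℚP.toℚᵘ-injective (begin
  toℚᵘ (+ 1 / (suc (suc u) ℕ.* suc u) + + 1 / suc (suc u))
    ≈⟨ ℚP.toℚᵘ-homo-+ (+ 1 / (suc (suc u) ℕ.* suc u)) (+ 1 / suc (suc u)) ⟩
  toℚᵘ (+ 1 / (suc (suc u) ℕ.* suc u)) ℚᵘ.+ toℚᵘ (+ 1 / suc (suc u))
    ≈⟨ ℚᵘP.+-cong (ℚP.toℚᵘ-fromℚᵘ p) (ℚP.toℚᵘ-fromℚᵘ q) ⟩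
  p ℚᵘ.+ q
    ≈⟨ ℚᵘ.*≡* (lemma (+ suc u)) ⟩
  r
    ≈⟨ ℚP.toℚᵘ-fromℚᵘ r ⟨
  toℚᵘ (+ 1 / suc u) ∎)
  where
  open import Relation.Binary.Reasoning.Setoid ℚᵘP.≃-setoid
  open ℤSolver.+-*-Solver
  p = ℚᵘ.mkℚᵘ (+ 1) (u ℕ.+ suc u ℕ.* suc u)
  q = ℚᵘ.mkℚᵘ (+ 1) (suc u)
  r = ℚᵘ.mkℚᵘ (+ 1) u
  lemma : ∀ x → (+ 1 ℤ.* (+ 1 ℤ.+ x) ℤ.+ + 1 ℤ.* ((+ 1 ℤ.+ x) ℤ.* x)) ℤ.* x
              ≡ + 1 ℤ.* (((+ 1 ℤ.+ x) ℤ.* x) ℤ.* (+ 1 ℤ.+ x))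
  lemma = solve 1
    (λ x → (con (+ 1) :* (con (+ 1) :+ x)
             :+ con (+ 1) :* ((con (+ 1) :+ x) :* x)) :* x
        := con (+ 1) :* (((con (+ 1) :+ x) :* x) :* (con (+ 1) :+ x))) refl

-- For k ≥ 2 and i ≥ 2:  i^{-k} ≤ 1/(i(i-1)) = 1/(i-1) - 1/i.

invPow-≤ : ∀ k → 2 ℕ.≤ k → ∀ u →
           invPow k (suc (suc u)) + + 1 / suc (suc u) ≤ + 1 / suc u
invPow-≤ k 2≤k u = subst (invPow k (suc (suc u)) + + 1 / suc (suc u) ≤_)
  (telescope u)
  (ℚP.+-monoˡ-≤ (+ 1 / suc (suc u))
    (1/-mono (suc (suc u) ℕ.^ k) (suc (suc u) ℕ.* suc u)
      {{ℕP.m^n≢0 (suc (suc u)) k}}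
      (ℕP.≤-trans
        (ℕP.*-monoʳ-≤ (suc (suc u))
          (subst (suc u ℕ.≤_) (sym (ℕP.*-identityʳ (suc (suc u))))
            (ℕP.n≤1+n (suc u))))
        (ℕP.^-monoʳ-≤ (suc (suc u)) 2≤k))))

0≤tailTerm : ∀ k n j → 0ℚ ≤ tailTerm k n j
0≤tailTerm k n j =
  ℚP.<⇒≤ (1/-pos ((suc n ℕ.+ j) ℕ.^ k) {{ℕP.m^n≢0 (suc n ℕ.+ j) k}})

module Convergence (k : ℕ) (2≤k : 2 ℕ.≤ k) (n : ℕ) where

  S : ℕ → ℚ
  S = partialSum (tailTerm k n)

  S-mono : ∀ d m → S m ≤ S (d ℕ.+ m)
  S-mono zero    m = ℚP.≤-refl
  S-mono (suc d) m = ℚP.≤-trans (S-mono d m)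
    (subst (_≤ S (suc d ℕ.+ m)) (ℚP.+-identityʳ (S (d ℕ.+ m)))
      (ℚP.+-monoʳ-≤ (S (d ℕ.+ m)) (0≤tailTerm k n (d ℕ.+ m))))

  term-≤ : ∀ m → tailTerm k n (suc m) + + 1 / suc (n ℕ.+ suc m)
               ≤ + 1 / suc (n ℕ.+ m)
  term-≤ m rewrite ℕP.+-suc n m = invPow-≤ k 2≤k (n ℕ.+ m)

  S-bound : ∀ d m → S (d ℕ.+ suc m) + + 1 / suc (n ℕ.+ (d ℕ.+ m))
                  ≤ S (suc m) + + 1 / suc (n ℕ.+ m)
  S-bound zero    m = ℚP.≤-refl
  S-bound (suc d) m = begin
    S (d ℕ.+ suc m) + tailTerm k n (d ℕ.+ suc m) + + 1 / suc (n ℕ.+ suc (d ℕ.+ m))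
      ≡⟨ ℚP.+-assoc (S (d ℕ.+ suc m)) _ _ ⟩
    S (d ℕ.+ suc m) + (tailTerm k n (d ℕ.+ suc m) + + 1 / suc (n ℕ.+ suc (d ℕ.+ m)))
      ≡⟨ cong (λ t → S (d ℕ.+ suc m) + (tailTerm k n t + + 1 / suc (n ℕ.+ suc (d ℕ.+ m))))
           (ℕP.+-suc d m) ⟩
    S (d ℕ.+ suc m) + (tailTerm k n (suc (d ℕ.+ m)) + + 1 / suc (n ℕ.+ suc (d ℕ.+ m)))
      ≤⟨ ℚP.+-monoʳ-≤ (S (d ℕ.+ suc m)) (term-≤ (d ℕ.+ m)) ⟩
    S (d ℕ.+ suc m) + + 1 / suc (n ℕ.+ (d ℕ.+ m))
      ≤⟨ S-bound d m ⟩
    S (suc m) + + 1 / suc (n ℕ.+ m) ∎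
    where open ℚP.≤-Reasoning

  S-gap : ∀ d m → S (d ℕ.+ suc m) - S (suc m) ≤ + 1 / suc m
  S-gap d m = begin
    S (d ℕ.+ suc m) - S (suc m)
      ≤⟨ ℚP.+-monoˡ-≤ (- S (suc m)) (ℚP.≤-trans
           (subst (_≤ S (d ℕ.+ suc m) + e) (ℚP.+-identityʳ (S (d ℕ.+ suc m)))
             (ℚP.+-monoʳ-≤ (S (d ℕ.+ suc m)) (ℚP.<⇒≤ (1/-pos (suc (n ℕ.+ (d ℕ.+ m)))))))
           (S-bound d m)) ⟩
    S (suc m) + + 1 / suc (n ℕ.+ m) - S (suc m)
      ≡⟨ lemma (S (suc m)) (+ 1 / suc (n ℕ.+ m)) ⟩
    + 1 / suc (n ℕ.+ m)
      ≤⟨ 1/-mono (suc (n ℕ.+ m)) (suc m) (s≤s (ℕP.m≤n+m m n)) ⟩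
    + 1 / suc m ∎
    where
    open ℚP.≤-Reasoning
    open ℚSolver.+-*-Solver
    e = + 1 / suc (n ℕ.+ (d ℕ.+ m))
    lemma : ∀ a b → a + b - a ≡ b
    lemma = solve 2 (λ a b → a :+ b :- a := b) refl

  S-close : ∀ N m p → suc N ℕ.≤ m → m ℕ.≤ p → ∣ S p - S m ∣ ≤ + 1 / suc N
  S-close N (suc m) p (s≤s N≤m) m≤p =
    subst (λ t → ∣ S t - S (suc m) ∣ ≤ + 1 / suc N) (ℕP.m∸n+n≡m m≤p)
      (subst (_≤ + 1 / suc N) (sym (ℚP.0≤p⇒∣p∣≡p nonneg))
        (ℚP.≤-trans (S-gap d m) (1/-mono (suc m) (suc N) (s≤s N≤m))))
    where
    d = p ℕ.∸ suc m
    nonneg : 0ℚ ≤ S (d ℕ.+ suc m) - S (suc m)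
    nonneg = subst (_≤ S (d ℕ.+ suc m) - S (suc m)) (ℚP.+-inverseʳ (S (suc m)))
      (ℚP.+-monoˡ-≤ (- S (suc m)) (S-mono d (suc m)))

  ∣-∣-sym : ∀ p q → ∣ p - q ∣ ≡ ∣ q - p ∣
  ∣-∣-sym p q = trans (cong ∣_∣ (lemma p q)) (ℚP.∣-p∣≡∣p∣ (q - p))
    where
    open ℚSolver.+-*-Solver
    lemma : ∀ a b → a - b ≡ - (b - a)
    lemma = solve 2 (λ a b → a :- b := :- (b :- a)) refl

  archimedean : ∀ ε → 0ℚ < ε → ∃[ N ] (+ 1 / suc N < ε)
  archimedean ε@(mkℚ (+ suc a) b _) _ = suc b , ℚP.toℚᵘ-cancel-<
    (ℚᵘP.<-respˡ-≃ (ℚᵘP.≃-sym (ℚP.toℚᵘ-fromℚᵘ (ℚᵘ.mkℚᵘ (+ 1) (suc b))))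
      (ℚᵘ.*<* (ℤ.+<+ (ℕP.≤-trans
        (s≤s (s≤s (ℕP.≤-reflexive (ℕP.+-identityʳ b))))
        (ℕP.m≤m+n (suc (suc b)) (a ℕ.* suc (suc b)))))))
  archimedean (mkℚ (+ zero) _ _) (*<* (ℤ.+<+ ()))
  archimedean (mkℚ (ℤ.-[1+ _ ]) _ _) (*<* ())

  summable : Summable (tailTerm k n)
  summable ε ε>0 with archimedean ε ε>0
  ... | N , 1/N<ε = suc N , λ m p N<m N<p → close m p N<m N<p (ℕP.≤-total m p)
    where
    close : ∀ m p → suc N ℕ.≤ m → suc N ℕ.≤ p → m ℕ.≤ p ⊎ p ℕ.≤ m →
            ∣ S m - S p ∣ < ε
    close m p N<m N<p (inj₁ m≤p) = subst (_< ε) (∣-∣-sym (S p) (S m))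
      (ℚP.≤-<-trans (S-close N m p N<m m≤p) 1/N<ε)
    close m p N<m N<p (inj₂ p≤m) =
      ℚP.≤-<-trans (S-close N p m N<p p≤m) 1/N<ε

tail-summable : ∀ k → 2 ℕ.≤ k → ∀ n → Summable (tailTerm k n)
tail-summable = Convergence.summable

tail : (k : ℕ) → 2 ℕ.≤ k → ℕ → ℝ
tail k 2≤k n = ∑∞ (tailTerm k n) (tail-summable k 2≤k n)

tail>0 : ∀ k (2≤k : 2 ℕ.≤ k) n → 0ℝ <ℝ tail k 2≤k n
tail>0 k 2≤k n =
  tailTerm k n 0 , 1/-pos ((suc n ℕ.+ 0) ℕ.^ k) {{ℕP.m^n≢0 (suc n ℕ.+ 0) k}} , 1 , λ where
    (suc m) _ → subst (λ t → 0ℚ + tailTerm k n 0 ≤ partialSum (tailTerm k n) t)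
      (ℕP.+-comm m 1) (Convergence.S-mono k 2≤k n m 1)

-- n and N₀ are natural numbers, since the sum has an undefined summand
-- (i = 0) when n is negative.

Brackets : (k : ℕ) → 2 ℕ.≤ k → Poly → Set
Brackets k 2≤k f = ∃[ N₀ ] (∀ n → N₀ ℕ.≤ n →
  let f[n]   = eval f (+ n / 1)
      1/tail = recip (tail k 2≤k n) (tail>0 k 2≤k n)
  in fromℚ f[n] <ℝ 1/tail × 1/tail <ℝ fromℚ (f[n] + 1ℚ))

{-# OPTIONS --safe #-}
-- For a polynomial p with K = k - 1 and x = n + 1, a comparison of 1/p(n) - 1/p(n+1)
-- with (n+1)^{-k} is the sign of the defect x^k (p(x) - p(x-1)) - p(x) p(x-1), and it
-- telescopes to a comparison of 1/p(n) with the tail of the series.  The leading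
-- coefficient K of p makes the defect have degree below 2K; adding b x^j changes its
-- coefficient at x^{K+j} by (j - 2K) b, so the coefficients of p can be chosen in
-- the order j = K-1, ..., 0 such that the defect has degree below K.  Replacing p by
-- p + c then changes the defect by -2Kc x^K plus lower terms, so p - 1/4 and p + 1/4
-- have defects of opposite signs for large x, which places 1/tail strictly between
-- p - 1/2 and p + 1/2, with room to spare.  Two solutions differ by less than 1 at
-- all large n, and a non-constant polynomial is unbounded.

module Submission where

open import Defs
open import Data.Nat.Base using (ℕ; _≤_; _∸_)
open import Data.Product.Base using (∃-syntax; _×_)
import Algebra.Definitions.RawSemiring
open import Data.Empty using (⊥; ⊥-elim)
open import Data.Integer.Base as ℤ using (+_)
import Data.Integer.Properties as ℤP
open import Data.List.Base using ([]; _∷_; map)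
open import Data.Nat.Base as ℕ using (zero; suc; z≤n; s≤s)
import Data.Nat.Properties as ℕP
open import Data.Product.Base using (_,_; proj₁; proj₂)
open import Data.Rational.Base
  using (ℚ; mkℚ; 0ℚ; 1ℚ; ½; _+_; _*_; _-_; -_; _/_; 1/_; *≤*;
         positive; nonNegative; toℚᵘ; +-*-rawSemiring)
  renaming (_≤_ to _≤ℚ_; _<_ to _<ℚ_)
import Data.Rational.Properties as ℚP
open import Data.Rational.Solver using (module +-*-Solver)
import Data.Rational.Unnormalised.Base as ℚᵘ
import Data.Rational.Unnormalised.Properties as ℚᵘP
open import Data.Sum.Base using (_⊎_; inj₁; inj₂; [_,_]′)
open import Relation.Binary.Definitions using (tri<; tri≈; tri>)
open import Relation.Binary.PropositionalEquality
open import Relation.Nullary using (yes; no; contradiction)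

open Algebra.Definitions.RawSemiring +-*-rawSemiring using (_^_)
open +-*-Solver

-- Ordered field arithmetic

0≤+ : ∀ {p q} → 0ℚ ≤ℚ p → 0ℚ ≤ℚ q → 0ℚ ≤ℚ p + q
0≤+ {p} {q} 0≤p 0≤q =
  ℚP.nonNegative⁻¹ (p + q) {{ℚP.nonNeg+nonNeg⇒nonNeg p {{nonNegative 0≤p}} q {{nonNegative 0≤q}}}}

0≤* : ∀ {p q} → 0ℚ ≤ℚ p → 0ℚ ≤ℚ q → 0ℚ ≤ℚ p * q
0≤* {p} {q} 0≤p 0≤q =
  ℚP.nonNegative⁻¹ (p * q) {{ℚP.nonNeg*nonNeg⇒nonNeg p {{nonNegative 0≤p}} q {{nonNegative 0≤q}}}}

0<* : ∀ {p q} → 0ℚ <ℚ p → 0ℚ <ℚ q → 0ℚ <ℚ p * q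
0<* {p} {q} 0<p 0<q =
  ℚP.positive⁻¹ (p * q) {{ℚP.pos*pos⇒pos p {{positive 0<p}} q {{positive 0<q}}}}

≤⇒0≤- : ∀ {p q} → p ≤ℚ q → 0ℚ ≤ℚ q - p
≤⇒0≤- {p} {q} p≤q = subst (_≤ℚ q - p) (ℚP.+-inverseʳ p) (ℚP.+-monoˡ-≤ (- p) p≤q)

<⇒0<- : ∀ {p q} → p <ℚ q → 0ℚ <ℚ q - p
<⇒0<- {p} {q} p<q = subst (_<ℚ q - p) (ℚP.+-inverseʳ p) (ℚP.+-monoˡ-< (- p) p<q)

p+d≡q⇒p≤q : ∀ {p q} d → p + d ≡ q → 0ℚ ≤ℚ d → p ≤ℚ q
p+d≡q⇒p≤q {p} d refl 0≤d = subst (_≤ℚ p + d) (ℚP.+-identityʳ p) (ℚP.+-monoʳ-≤ p 0≤d)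

p+d≡q⇒p<q : ∀ {p q} d → p + d ≡ q → 0ℚ <ℚ d → p <ℚ q
p+d≡q⇒p<q {p} d refl 0<d = subst (_<ℚ p + d) (ℚP.+-identityʳ p) (ℚP.+-monoʳ-< p 0<d)

inverse>0 : ∀ {p q} → 0ℚ <ℚ q → p * q ≡ 1ℚ → 0ℚ <ℚ p
inverse>0 {p} {q} 0<q pq≡1 =
  ℚP.*-cancelʳ-<-nonNeg q {{ℚP.pos⇒nonNeg q {{positive 0<q}}}}
    (subst₂ _<ℚ_ (sym (ℚP.*-zeroˡ q)) (sym pq≡1) (ℚP.positive⁻¹ 1ℚ))

-- Naturals as rationals

ι : ℕ → ℚ
ι n = + n / 1

toℚᵘ-ι : ∀ n → toℚᵘ (ι n) ℚᵘ.≃ ℚᵘ.mkℚᵘ (+ n) 0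
toℚᵘ-ι n = ℚP.toℚᵘ-fromℚᵘ (ℚᵘ.mkℚᵘ (+ n) 0)

ι-+ : ∀ m n → ι (m ℕ.+ n) ≡ ι m + ι n
ι-+ m n = ℚP.toℚᵘ-injective (begin
  toℚᵘ (ι (m ℕ.+ n))                            ≈⟨ toℚᵘ-ι (m ℕ.+ n) ⟩
  ℚᵘ.mkℚᵘ (+ (m ℕ.+ n)) 0
    ≡⟨ cong (λ z → ℚᵘ.mkℚᵘ z 0) (cong₂ ℤ._+_ (ℤP.*-identityʳ (+ m)) (ℤP.*-identityʳ (+ n))) ⟨
  ℚᵘ.mkℚᵘ (+ m) 0 ℚᵘ.+ ℚᵘ.mkℚᵘ (+ n) 0          ≈⟨ ℚᵘP.+-cong (toℚᵘ-ι m) (toℚᵘ-ι n) ⟨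
  toℚᵘ (ι m) ℚᵘ.+ toℚᵘ (ι n)                    ≈⟨ ℚP.toℚᵘ-homo-+ (ι m) (ι n) ⟨
  toℚᵘ (ι m + ι n)                              ∎)
  where open import Relation.Binary.Reasoning.Setoid ℚᵘP.≃-setoid

ι-* : ∀ m n → ι (m ℕ.* n) ≡ ι m * ι n
ι-* m n = ℚP.toℚᵘ-injective (begin
  toℚᵘ (ι (m ℕ.* n))                            ≈⟨ toℚᵘ-ι (m ℕ.* n) ⟩
  ℚᵘ.mkℚᵘ (+ (m ℕ.* n)) 0                       ≡⟨ cong (λ z → ℚᵘ.mkℚᵘ z 0) (ℤP.pos-* m n) ⟩
  ℚᵘ.mkℚᵘ (+ m) 0 ℚᵘ.* ℚᵘ.mkℚᵘ (+ n) 0          ≈⟨ ℚᵘP.*-cong (toℚᵘ-ι m) (toℚᵘ-ι n) ⟨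
  toℚᵘ (ι m) ℚᵘ.* toℚᵘ (ι n)                    ≈⟨ ℚP.toℚᵘ-homo-* (ι m) (ι n) ⟨
  toℚᵘ (ι m * ι n)                              ∎)
  where open import Relation.Binary.Reasoning.Setoid ℚᵘP.≃-setoid

ι-^ : ∀ m k → ι (m ℕ.^ k) ≡ ι m ^ k
ι-^ m zero    = refl
ι-^ m (suc k) = trans (ι-* m (m ℕ.^ k)) (cong (ι m *_) (ι-^ m k))

ι-suc : ∀ n → ι (suc n) ≡ ι n + 1ℚ
ι-suc n = trans (cong ι (ℕP.+-comm 1 n)) (ι-+ n 1)

ι-pred : ∀ n → ι (suc n) - 1ℚ ≡ ι n
ι-pred n = trans (cong (_- 1ℚ) (ι-suc n))
  (solve 1 (λ x → x :+ con 1ℚ :- con 1ℚ := x) refl (ι n))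

0≤ι : ∀ n → 0ℚ ≤ℚ ι n
0≤ι n = ℚP.nonNegative⁻¹ (ι n) {{ℚP.normalize-nonNeg n 1}}

ι-suc>0 : ∀ n → 0ℚ <ℚ ι (suc n)
ι-suc>0 n = ℚP.positive⁻¹ (ι (suc n)) {{ℚP.normalize-pos (suc n) 1}}

ι-mono : ∀ {m n} → m ≤ n → ι m ≤ℚ ι n
ι-mono {m} {n} m≤n = p+d≡q⇒p≤q (ι (n ∸ m))
  (trans (sym (ι-+ m (n ∸ m))) (cong ι (ℕP.m+[n∸m]≡n m≤n))) (0≤ι (n ∸ m))

1/n*n : ∀ n .{{_ : ℕ.NonZero n}} → (+ 1 / n) * ι n ≡ 1ℚ
1/n*n n@(suc m) = ℚP.toℚᵘ-injective (begin
  toℚᵘ ((+ 1 / n) * ι n)                      ≈⟨ ℚP.toℚᵘ-homo-* (+ 1 / n) (ι n) ⟩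
  toℚᵘ (+ 1 / n) ℚᵘ.* toℚᵘ (ι n)              ≈⟨ ℚᵘP.*-cong (ℚP.toℚᵘ-fromℚᵘ (ℚᵘ.mkℚᵘ (+ 1) m)) (toℚᵘ-ι n) ⟩
  ℚᵘ.mkℚᵘ (+ 1) m ℚᵘ.* ℚᵘ.mkℚᵘ (+ n) 0        ≈⟨ ℚᵘ.*≡* (cong +_ (cong suc (trans (cong (ℕ._* 1) (ℕP.+-identityʳ m)) (ℕP.+-comm 0 (m ℕ.* 1))))) ⟩
  toℚᵘ 1ℚ                                     ∎)
  where open import Relation.Binary.Reasoning.Setoid ℚᵘP.≃-setoid

-- A nonnegative fraction is at most its numerator, since its denominator is at least 1.
≤-ι : ∀ q → ∃[ n ] q ≤ℚ ι n
≤-ι q@(mkℚ (+ a) b _) = a , ℚP.toℚᵘ-cancel-≤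
  (ℚᵘP.≤-respʳ-≃ (ℚᵘP.≃-sym (toℚᵘ-ι a))
    (ℚᵘ.*≤* (ℤP.*-monoˡ-≤-nonNeg (+ a) (ℤ.+≤+ (s≤s z≤n)))))
≤-ι (mkℚ ℤ.-[1+ a ] b _) = 0 , *≤* ℤ.-≤+

-- Polynomial functions

-- e is a polynomial function of degree at most d whose coefficient at x^d is c
-- (possibly 0).
data HasTop : ℕ → ℚ → (ℚ → ℚ) → Set where
  const  : ∀ {c e} → (∀ x → e x ≡ c) → HasTop 0 c e
  horner : ∀ {d c e e′} a → HasTop d c e′ → (∀ x → e x ≡ a + x * e′ x) → HasTop (suc d) c e

top-resp : ∀ {d c c′ e e′} → c ≡ c′ → (∀ x → e′ x ≡ e x) → HasTop d c e → HasTop d c′ e′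
top-resp refl eq (const h)      = const λ x → trans (eq x) (h x)
top-resp refl eq (horner a t h) = horner a t λ x → trans (eq x) (h x)

top-+ : ∀ {d c c′ e e′} → HasTop d c e → HasTop d c′ e′ → HasTop d (c + c′) (λ x → e x + e′ x)
top-+ (const h) (const h′) = const λ x → cong₂ _+_ (h x) (h′ x)
top-+ (horner {e′ = f} a t h) (horner {e′ = g} b u h′) = horner (a + b) (top-+ t u) λ x →
  trans (cong₂ _+_ (h x) (h′ x))
    (solve 5 (λ a b x f g → (a :+ x :* f) :+ (b :+ x :* g) := a :+ b :+ x :* (f :+ g)) refl
      a b x (f x) (g x))

top-scale : ∀ {d c e} q → HasTop d c e → HasTop d (q * c) (λ x → q * e x)
top-scale q (const h) = const λ x → cong (q *_) (h x)
top-scale q (horner {e′ = f} a t h) = horner (q * a) (top-scale q t) λ x →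
  trans (cong (q *_) (h x))
    (solve 4 (λ q a x f → q :* (a :+ x :* f) := q :* a :+ x :* (q :* f)) refl q a x (f x))

top-neg : ∀ {d c e} → HasTop d c e → HasTop d (- c) (λ x → - e x)
top-neg {c = c} {e} t = top-resp (neg c) (λ x → sym (neg (e x))) (top-scale (- 1ℚ) t)
  where
  neg : ∀ p → - 1ℚ * p ≡ - p
  neg = solve 1 (λ p → con (- 1ℚ) :* p := :- p) refl

top-raise : ∀ {d c e} → HasTop d c e → HasTop (suc d) 0ℚ e
top-raise {c = c} (const h) = horner {e′ = λ _ → 0ℚ} c (const λ _ → refl) λ x →
  trans (h x) (solve 2 (λ c x → c := c :+ x :* con 0ℚ) refl c x)
top-raise (horner a t h) = horner a (top-raise t) h

top-raise-< : ∀ {d d′ c e} → d ℕ.<′ d′ → HasTop d c e → HasTop d′ 0ℚ e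
top-raise-< ℕ.<′-base         t = top-raise t
top-raise-< (ℕ.<′-step d<d′) t = top-raise (top-raise-< d<d′ t)

top-+const : ∀ {d c e} q → HasTop (suc d) c e → HasTop (suc d) c (λ x → e x + q)
top-+const q (horner {e′ = f} a t h) = horner (a + q) t λ x → trans (cong (_+ q) (h x))
  (solve 4 (λ a q x f → a :+ x :* f :+ q := a :+ q :+ x :* f) refl a q x (f x))

top-lower : ∀ {d e} → HasTop (suc d) 0ℚ e → ∃[ c ] HasTop d c e
top-lower (horner a (const h) h′) = a , const λ x →
  trans (h′ x) (trans (cong (λ z → a + x * z) (h x))
    (solve 2 (λ a x → a :+ x :* con 0ℚ := a) refl a x))
top-lower (horner a t@(horner _ _ _) h) with top-lower t
... | c , u = c , horner a u h

top-x* : ∀ {d c e} → HasTop d c e → HasTop (suc d) c (λ x → x * e x)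
top-x* t = horner 0ℚ t λ x → sym (ℚP.+-identityˡ _)

top-^ : ∀ d → HasTop d 1ℚ (_^ d)
top-^ zero    = const λ _ → refl
top-^ (suc d) = top-x* (top-^ d)

top-* : ∀ {d d′ c c′ e e′} → HasTop d c e → HasTop d′ c′ e′ →
        HasTop (d ℕ.+ d′) (c * c′) (λ x → e x * e′ x)
top-* {c = c} {e′ = e′} (const h) u = top-resp refl (λ x → cong (_* e′ x) (h x)) (top-scale c u)
top-* {d = suc d} {d′} {c} {c′} {e′ = g} (horner {e′ = f} a t h) u =
  top-resp (ℚP.+-identityˡ (c * c′))
    (λ x → trans (cong (_* g x) (h x))
      (solve 4 (λ a x f g → (a :+ x :* f) :* g := a :* g :+ x :* (f :* g)) refl a x (f x) (g x)))
    -- In (a + x f) g the summand a g stays below the top degree, and x (f g) carries the top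
    -- coefficient.
    (top-+ (top-raise-< (ℕP.≤⇒≤′ (s≤s (ℕP.m≤n+m d′ d))) (top-scale a u)) (top-x* (top-* t u)))

-- (x - 1) f(x - 1) = x f(x - 1) - f(x - 1), and the last term has lower degree.
top-shift : ∀ {d c e} → HasTop d c e → HasTop d c (λ x → e (x - 1ℚ))
top-shift (const h) = const λ x → h (x - 1ℚ)
top-shift {c = c} (horner {e′ = f} a t h) =
  top-resp (ℚP.+-identityʳ c)
    (λ x → trans (h (x - 1ℚ))
      (solve 3 (λ a x f → a :+ (x :- con 1ℚ) :* f := a :+ x :* f :+ :- f) refl a x (f (x - 1ℚ))))
    (top-+ (horner a (top-shift t) λ _ → refl) (top-raise (top-neg (top-shift t))))

Δ : (ℚ → ℚ) → ℚ → ℚ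
Δ e x = e x - e (x - 1ℚ)

-- The backward difference is multiplied by x so that the degree is preserved
-- for every d, including 0.
top-xΔ : ∀ {d c e} → HasTop d c e → HasTop d (ι d * c) (λ x → x * Δ e x)
top-xΔ {c = c} (const h) = const λ x →
  trans (cong₂ (λ u v → x * (u - v)) (h x) (h (x - 1ℚ)))
    (solve 2 (λ x c → x :* (c :- c) := con 0ℚ :* c) refl x c)
top-xΔ {d = suc d} {c} (horner {e′ = f} a t h) =
  top-resp
    (trans (solve 2 (λ n c → n :* c :+ c := (n :+ con 1ℚ) :* c) refl (ι d) c)
      (cong (_* c) (sym (ι-suc d))))
    (λ x → trans (cong₂ (λ u v → x * (u - v)) (h x) (h (x - 1ℚ)))
      (solve 4 (λ a x u v → x :* ((a :+ x :* u) :- (a :+ (x :- con 1ℚ) :* v))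
        := x :* (x :* (u :- v) :+ v)) refl a x (f x) (f (x - 1ℚ))))
    (top-x* (top-+ (top-xΔ t) (top-shift t)))

-- A proof of `HasTop` stores the Horner coefficients, so the coefficient list is read off it at the
-- end.
toPoly : ∀ {d c e} → HasTop d c e → Poly
toPoly (const {c} _)  = c ∷ []
toPoly (horner a t _) = a ∷ toPoly t

eval-toPoly : ∀ {d c e} (t : HasTop d c e) x → eval (toPoly t) x ≡ e x
eval-toPoly (const {c} h) x = trans (solve 2 (λ c x → c :+ x :* con 0ℚ := c) refl c x) (sym (h x))
eval-toPoly (horner a t h) x = trans (cong (λ z → a + x * z) (eval-toPoly t x)) (sym (h x))

coeff-toPoly : ∀ {d c e} (t : HasTop d c e) → coeff (toPoly t) d ≡ c
coeff-toPoly (const _)      = refl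
coeff-toPoly (horner _ t _) = coeff-toPoly t

coeff-toPoly-> : ∀ {d c e} (t : HasTop d c e) i → d ℕ.< i → coeff (toPoly t) i ≡ 0ℚ
coeff-toPoly-> (const _)      (suc i) _         = refl
coeff-toPoly-> (horner _ t _) (suc i) (s≤s d<i) = coeff-toPoly-> t i d<i

-- Behaviour at infinity

Eventually : (ℕ → Set) → Set
Eventually P = ∃[ N ] (∀ n → N ≤ n → P n)

ι*-unbounded : ∀ {δ} → 0ℚ <ℚ δ → ∀ q → Eventually λ n → q ≤ℚ ι n * δ
ι*-unbounded {δ} δ>0 q =
  let N , q/δ≤N = ≤-ι (q * 1/ δ)
  in N , λ n N≤n → subst (_≤ℚ ι n * δ) q/δ*δ≡q
    (ℚP.*-monoʳ-≤-nonNeg δ {{nonNegative (ℚP.<⇒≤ δ>0)}} (ℚP.≤-trans q/δ≤N (ι-mono N≤n)))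
  where
  instance _ = ℚP.pos⇒nonZero δ {{positive δ>0}}
  q/δ*δ≡q : q * 1/ δ * δ ≡ q
  q/δ*δ≡q = trans (ℚP.*-assoc q (1/ δ) δ)
    (trans (cong (q *_) (ℚP.*-inverseˡ δ)) (ℚP.*-identityʳ q))

≤-horner : ∀ {a x y δ} → 0ℚ ≤ℚ x → δ ≤ℚ y → δ - a ≤ℚ x * δ → δ ≤ℚ a + x * y
≤-horner {a} {x} {y} {δ} 0≤x δ≤y δ-a≤xδ =
  p+d≡q⇒p≤q (x * (y - δ) + (x * δ - (δ - a)))
    (solve 4 (λ a x y δ → δ :+ (x :* (y :- δ) :+ (x :* δ :- (δ :- a))) := a :+ x :* y) refl a x y δ)
    (0≤+ (0≤* 0≤x (≤⇒0≤- δ≤y)) (≤⇒0≤- δ-a≤xδ))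

-- The innermost constant `c` serves as `δ` at every Horner level: if e′ ≥ δ, then a + x e′ ≥ δ as
-- soon as x δ ≥ δ - a. A uniform bound, unlike mere positivity, passes through this induction.
top>0⇒bounded-below : ∀ {d c e} → HasTop d c e → 0ℚ <ℚ c →
  ∃[ δ ] (0ℚ <ℚ δ × Eventually λ n → δ ≤ℚ e (ι n))
top>0⇒bounded-below {c = c} (const h) c>0 =
  c , c>0 , 0 , λ n _ → ℚP.≤-reflexive (sym (h (ι n)))
top>0⇒bounded-below (horner a t h) c>0 =
  let δ , δ>0 , N , f≥δ = top>0⇒bounded-below t c>0
      M , large = ι*-unbounded δ>0 (δ - a)
  in δ , δ>0 , N ℕ.⊔ M , λ n N⊔M≤n → subst (δ ≤ℚ_) (sym (h (ι n)))
    (≤-horner (0≤ι n) (f≥δ n (ℕP.m⊔n≤o⇒m≤o N M N⊔M≤n)) (large n (ℕP.m⊔n≤o⇒n≤o N M N⊔M≤n)))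

top>0⇒eventually>0 : ∀ {d c e} → HasTop d c e → 0ℚ <ℚ c → Eventually λ n → 0ℚ <ℚ e (ι n)
top>0⇒eventually>0 t c>0 =
  let δ , δ>0 , N , e≥δ = top>0⇒bounded-below t c>0
  in N , λ n N≤n → ℚP.<-≤-trans δ>0 (e≥δ n N≤n)

-- In degree at least 1, subtracting `B` leaves the leading coefficient unchanged, so e - B is
-- eventually positive too.
top>0⇒unbounded : ∀ {d c e} → HasTop (suc d) c e → 0ℚ <ℚ c → ∀ B →
  Eventually λ n → B <ℚ e (ι n)
top>0⇒unbounded {e = e} t c>0 B =
  let N , e-B>0 = top>0⇒eventually>0 (top-+const (- B) t) c>0
  in N , λ n N≤n → p+d≡q⇒p<q _ (B+[y-B]≡y B (e (ι n))) (e-B>0 n N≤n)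
  where
  B+[y-B]≡y : ∀ B y → B + (y - B) ≡ y
  B+[y-B]≡y = solve 2 (λ B y → B :+ (y :- B) := y) refl

≢0⇒0<±p : ∀ {p} → p ≢ 0ℚ → 0ℚ <ℚ p ⊎ 0ℚ <ℚ - p
≢0⇒0<±p {p} p≢0 with ℚP.<-cmp 0ℚ p
... | tri< 0<p _ _ = inj₁ 0<p
... | tri≈ _ 0≡p _ = contradiction (sym 0≡p) p≢0
... | tri> _ _ p<0 = inj₂ (ℚP.neg-antimono-< p<0)

-- Lists may end in zeros, so the true degree is found from the far end, by deciding whether each
-- coefficient is 0.
zero-or-top : ∀ p → ((∀ i → coeff p i ≡ 0ℚ) × (∀ x → eval p x ≡ 0ℚ))
                  ⊎ ∃[ d ] ∃[ c ] (c ≢ 0ℚ × HasTop d c (eval p))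
zero-or-top [] = inj₁ ((λ _ → refl) , λ _ → refl)
zero-or-top (a ∷ p) with zero-or-top p | a ℚP.≟ 0ℚ
... | inj₂ (d , c , c≢0 , t) | _        = inj₂ (suc d , c , c≢0 , horner a t λ _ → refl)
... | inj₁ (_ , p≡0)         | no a≢0   = inj₂ (0 , a , a≢0 , const λ x →
  trans (cong (λ y → a + x * y) (p≡0 x)) (solve 2 (λ a x → a :+ x :* con 0ℚ := a) refl a x))
... | inj₁ (coeff≡0 , p≡0)   | yes refl = inj₁
  ((λ { zero → refl ; (suc i) → coeff≡0 i }) , λ x →
    trans (cong (λ y → 0ℚ + x * y) (p≡0 x)) (solve 1 (λ x → con 0ℚ :+ x :* con 0ℚ := con 0ℚ) refl x))

-- If the tail of the list is not the zero polynomial, the whole has degree at least 1 with a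
-- nonzero leading coefficient, so it or its negative eventually exceeds 1.
bounded⇒constant : ∀ p → (Eventually λ n → eval p (ι n) <ℚ 1ℚ) →
  (Eventually λ n → - eval p (ι n) <ℚ 1ℚ) →
  ∀ i → coeff p (suc i) ≡ 0ℚ
bounded⇒constant []      _     _    _ = refl
bounded⇒constant (a ∷ p) above below i =
  [ (λ (coeff≡0 , _) → coeff≡0 i)
  , (λ (d , c , c≢0 , t) → let u = horner a t λ _ → refl in
      ⊥-elim ([ (λ 0<c → clash u 0<c above) , (λ 0<-c → clash (top-neg u) 0<-c below) ]′ (≢0⇒0<±p c≢0)))
  ]′ (zero-or-top p)
  where
  clash : ∀ {d c e} → HasTop (suc d) c e → 0ℚ <ℚ c → (Eventually λ n → e (ι n) <ℚ 1ℚ) → ⊥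
  clash t c>0 (M , e<1) =
    let N , 1<e = top>0⇒unbounded t c>0 1ℚ
    in ℚP.<-asym (1<e (M ℕ.⊔ N) (ℕP.m≤n⊔m M N)) (e<1 (M ℕ.⊔ N) (ℕP.m≤m⊔n M N))

-- Cancelling the non-constant coefficients

-- For k = K + 1, where x^K * x = x^k; it equals
-- x^k p(x) p(x-1) (1/p(x-1) - 1/p(x) - x^{-k}).
defect : ℕ → (ℚ → ℚ) → ℚ → ℚ
defect K p x = x ^ K * (x * Δ p x) - p x * p (x - 1ℚ)

-- The corrections are kept as separate summands so that the degree and top coefficient of each can
-- be read off by itself.
defect-+ : ∀ K p q x → defect K (λ y → p y + q y) x ≡
  defect K p x + x ^ K * (x * Δ q x) + - (p x * q (x - 1ℚ)) + - (p (x - 1ℚ) * q x)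
    + - (q x * q (x - 1ℚ))
defect-+ K p q x =
  solve 6 (λ y x p p′ q q′ →
      y :* (x :* (p :+ q :- (p′ :+ q′))) :- (p :+ q) :* (p′ :+ q′)
    := y :* (x :* (p :- p′)) :- p :* p′ :+ y :* (x :* (q :- q′)) :+ :- (p :* q′) :+ :- (p′ :* q)
         :+ :- (q :* q′)) refl
    (x ^ K) x (p x) (p (x - 1ℚ)) (q x) (q (x - 1ℚ))

NearSolution : ℕ → ℕ → Set
NearSolution K j = ∃[ p ] (HasTop K (ι K) p × HasTop (K ℕ.+ j) 0ℚ (defect K p))

-- For K x^K, both terms of the defect have coefficient K² at x^(2K), and these cancel.
monomial-near : ∀ K → NearSolution K K
monomial-near K = p , p-top , top-resp
  (solve 1 (λ κ → con 1ℚ :* (κ :* κ) :+ :- (κ :* κ) := con 0ℚ) refl (ι K))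
  (λ _ → refl)
  (top-+ (top-* (top-^ K) (top-xΔ p-top)) (top-neg (top-* p-top (top-shift p-top))))
  where
  p : ℚ → ℚ
  p x = ι K * x ^ K
  p-top : HasTop K (ι K) p
  p-top = top-resp (ℚP.*-identityʳ (ι K)) (λ _ → refl) (top-scale (ι K) (top-^ K))

-- The divisor is w = 2K - j = K + r + 1.
improve : ∀ {K j} r → j ℕ.+ suc r ≡ K → NearSolution K (suc j) → NearSolution K j
improve {K} {j} r j+1+r≡K (p , p-top , defect-top) =
  (λ x → p x + q x) ,
  top-resp (ℚP.+-identityʳ (ι K)) (λ _ → refl) (top-+ p-top (top-raise-< j<K q-top)) ,
  top-resp (cancel (ι K) (ι j) (ι (suc r)) c v κ≡j+R v-inverse) (defect-+ K p q)
    (top-+ (top-+ (top-+ (top-+ c-top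
      (top-* (top-^ K) (top-xΔ q-top)))
      (top-neg (top-* p-top (top-shift q-top))))
      (top-neg (top-* (top-shift p-top) q-top)))
      -- The quadratic correction has degree at most 2j, which is below K + j because j < K.
      (top-neg (top-raise-< (ℕP.≤⇒≤′ (ℕP.+-monoˡ-≤ j (ℕP.≤′⇒≤ j<K))) (top-* q-top (top-shift q-top)))))
  where
  -- The defect is already 0 at x^(K+j+1); its coefficient `c` at x^(K+j) is to be removed by adding
  -- (c/w) x^j.
  lowered : ∃[ c ] HasTop (K ℕ.+ j) c (defect K p)
  lowered = top-lower (subst (λ d → HasTop d 0ℚ (defect K p)) (ℕP.+-suc K j) defect-top)
  c = proj₁ lowered
  c-top = proj₂ lowered
  w : ℕ
  w = suc (K ℕ.+ r)
  v = + 1 / w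
  q : ℚ → ℚ
  q x = c * v * x ^ j
  q-top : HasTop j (c * v) q
  q-top = top-resp (ℚP.*-identityʳ (c * v)) (λ _ → refl) (top-scale (c * v) (top-^ j))
  j<K : j ℕ.<′ K
  j<K = ℕP.≤⇒≤′ (subst (suc j ≤_) (trans (sym (ℕP.+-suc j r)) j+1+r≡K) (s≤s (ℕP.m≤m+n j r)))
  κ≡j+R : ι K ≡ ι j + ι (suc r)
  κ≡j+R = trans (cong ι (sym j+1+r≡K)) (ι-+ j (suc r))
  v-inverse : v * (ι K + ι (suc r)) ≡ 1ℚ
  v-inverse = trans (cong (v *_) (trans (sym (ι-+ K (suc r))) (cong ι (ℕP.+-suc K r)))) (1/n*n w)
  -- The new coefficient is c (1 - v (2κ - J)), where 2κ - J = κ + R.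
  cancel : ∀ κ J R c v → κ ≡ J + R → v * (κ + R) ≡ 1ℚ →
    c + 1ℚ * (J * (c * v)) + - (κ * (c * v)) + - (κ * (c * v)) + - 0ℚ ≡ 0ℚ
  cancel κ J R c v refl v-inv = trans
    (solve 4 (λ J R c v → c :+ con 1ℚ :* (J :* (c :* v)) :+ :- ((J :+ R) :* (c :* v))
        :+ :- ((J :+ R) :* (c :* v)) :+ :- con 0ℚ
      := c :* (con 1ℚ :- v :* (J :+ R :+ R))) refl J R c v)
    (trans (cong (λ z → c * (1ℚ - z)) v-inv)
      (solve 1 (λ c → c :* (con 1ℚ :- con 1ℚ) := con 0ℚ) refl c))

-- Induction on r = K - j, the number of coefficients chosen below the leading one.
nearSolution : ∀ {K} r j → j ℕ.+ r ≡ K → NearSolution K j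
nearSolution zero    j j+0≡K   =
  subst (NearSolution _) (trans (sym j+0≡K) (ℕP.+-identityʳ j)) (monomial-near _)
nearSolution (suc r) j j+1+r≡K =
  improve r j+1+r≡K (nearSolution r (suc j) (trans (sym (ℕP.+-suc j r)) j+1+r≡K))

-- Telescoping

-- Telescoping without division, for G = p(x), G′ = p(x-1), H = p(n), y = x^K and T = x^(-k). The
-- claim times `G′` is `G` times the hypothesis for `S` plus H T times the signed defect.
telescope-step : ∀ {σ S T H G G′ x y} →
  0ℚ <ℚ G′ → 0ℚ ≤ℚ G → 0ℚ ≤ℚ H → 0ℚ ≤ℚ T → T * (x * y) ≡ 1ℚ →
  0ℚ ≤ℚ σ * (y * (x * (G - G′)) - G * G′) →
  0ℚ ≤ℚ σ * ((1ℚ - S * H) * G′ - H) →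
  0ℚ ≤ℚ σ * ((1ℚ - (S + T) * H) * G - H)
telescope-step {σ} {S} {T} {H} {G} {G′} {x} {y} 0<G′ 0≤G 0≤H 0≤T Txy≡1 0≤def 0≤ih =
  ℚP.*-cancelˡ-≤-pos G′ {{positive 0<G′}}
    (p+d≡q⇒p≤q (G * (σ * ((1ℚ - S * H) * G′ - H)) + H * (T * (σ * (y * (x * (G - G′)) - G * G′))))
      (identity Txy≡1)
      (0≤+ (0≤* 0≤G 0≤ih) (0≤* 0≤H (0≤* 0≤T 0≤def))))
  where
  identity : T * (x * y) ≡ 1ℚ →
    G′ * 0ℚ + (G * (σ * ((1ℚ - S * H) * G′ - H)) + H * (T * (σ * (y * (x * (G - G′)) - G * G′))))
    ≡ G′ * (σ * ((1ℚ - (S + T) * H) * G - H))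
  identity Txy≡1 = trans
    -- The ring identity carries an error term with factor T x y - 1, which `Txy≡1` then makes
    -- vanish.
    (solve 8 (λ σ S T H G G′ x y →
        G′ :* con 0ℚ :+ (G :* (σ :* ((con 1ℚ :- S :* H) :* G′ :- H))
          :+ H :* (T :* (σ :* (y :* (x :* (G :- G′)) :- G :* G′))))
      := G′ :* (σ :* ((con 1ℚ :- (S :+ T) :* H) :* G :- H))
          :+ H :* σ :* (G :- G′) :* (T :* (x :* y) :- con 1ℚ)) refl σ S T H G G′ x y)
    (trans (cong (λ z → G′ * (σ * ((1ℚ - (S + T) * H) * G - H)) + H * σ * (G - G′) * (z - 1ℚ)) Txy≡1)
      (solve 2 (λ u v → u :+ v :* (con 1ℚ :- con 1ℚ) := u) refl
        (G′ * (σ * ((1ℚ - (S + T) * H) * G - H))) (H * σ * (G - G′))))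

tailTerm-inverse : ∀ K n j → tailTerm (suc K) n j * (ι (suc (n ℕ.+ j)) * ι (suc (n ℕ.+ j)) ^ K) ≡ 1ℚ
tailTerm-inverse K n j = trans
  (cong (tailTerm (suc K) n j *_) (sym (ι-^ (suc (n ℕ.+ j)) (suc K))))
  (1/n*n (suc (n ℕ.+ j) ℕ.^ suc K) {{ℕP.m^n≢0 (suc (n ℕ.+ j)) (suc K)}})

-- For σ = 1 and S the m-th partial sum this says S ≤ 1/p(n) - 1/p(n+m), and for
-- σ = -1 the reverse.
telescoped : ∀ σ K p n →
  (∀ i → n ≤ i → 0ℚ <ℚ p (ι i)) →
  (∀ i → n ≤ i → 0ℚ ≤ℚ σ * defect K p (ι i)) →
  ∀ m → 0ℚ ≤ℚ σ * ((1ℚ - partialSum (tailTerm (suc K) n) m * p (ι n)) * p (ι (n ℕ.+ m)) - p (ι n))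
telescoped σ K p n p>0 def≥0 zero =
  ℚP.≤-reflexive (sym (trans
    (cong (λ i → σ * ((1ℚ - 0ℚ * p (ι n)) * p (ι i) - p (ι n))) (ℕP.+-identityʳ n))
    (zero-sum σ (p (ι n)))))
  where
  zero-sum : ∀ σ H → σ * ((1ℚ - 0ℚ * H) * H - H) ≡ 0ℚ
  zero-sum = solve 2 (λ σ H → σ :* ((con 1ℚ :- con 0ℚ :* H) :* H :- H) := con 0ℚ) refl
telescoped σ K p n p>0 def≥0 (suc m) =
  subst (λ i → 0ℚ ≤ℚ σ * ((1ℚ - partialSum (tailTerm (suc K) n) (suc m) * p (ι n)) * p (ι i) - p (ι n)))
    (sym (ℕP.+-suc n m))
    (telescope-step {σ} {S = partialSum (tailTerm (suc K) n) m} {x = ι (suc i)} {y = ι (suc i) ^ K}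
      (p>0 i n≤i) (ℚP.<⇒≤ (p>0 (suc i) n≤1+i)) (ℚP.<⇒≤ (p>0 n ℕP.≤-refl))
      (0≤tailTerm (suc K) n m) (tailTerm-inverse K n m)
      (subst (λ y → 0ℚ ≤ℚ σ * (ι (suc i) ^ K * (ι (suc i) * (p (ι (suc i)) - p y)) - p (ι (suc i)) * p y))
        (ι-pred i) (def≥0 (suc i) n≤1+i))
      (telescoped σ K p n p>0 def≥0 m))
  where
  i = n ℕ.+ m
  n≤i : n ≤ i
  n≤i = ℕP.m≤m+n n m
  n≤1+i : n ≤ suc i
  n≤1+i = ℕP.m≤n⇒m≤1+n n≤i

-- With f = p - ½ there is room ½ on each side of p. A shift by ¼ fixes the sign of the defect. The
-- other ¼ is the separation below; above, it is split into ⅛ for stopping the sum at a finite index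
-- and ⅛ for the separation.
¼ ⅛ : ℚ
¼ = ½ * ½
⅛ = ½ * ¼

-- Only the terms linear in `c` reach the top, giving -2cκ; multiplied by `σ` this is κ/2 > 0. The
-- condition on σ c treats the shifts by -¼ and ¼ at once.
shifted-defect-top : ∀ {d} p → HasTop (suc d) (ι (suc d)) p → HasTop (suc d) 0ℚ (defect (suc d) p) →
  ∀ σ c → σ * c ≡ - ¼ → HasTop (suc d) (½ * ι (suc d)) (λ x → σ * defect (suc d) (λ y → p y + c) x)
shifted-defect-top {d} p p-top defect-top σ c σc≡-¼ = top-resp coefficient
  (λ x → cong (σ *_) (trans (defect-+ (suc d) p (λ _ → c) x)
    (solve 6 (λ D y x p p′ c → D :+ y :* (x :* (c :- c)) :+ :- (p :* c) :+ :- (p′ :* c) :+ :- (c :* c)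
        := D :+ :- (c :* p) :+ :- (c :* p′) :+ :- (c :* c)) refl
      (defect (suc d) p x) (x ^ suc d) x (p x) (p (x - 1ℚ)) c)))
  (top-scale σ (top-+ (top-+ (top-+ defect-top
    (top-neg (top-scale c p-top))) (top-neg (top-scale c (top-shift p-top))))
    (top-neg (top-raise-< (ℕP.≤⇒≤′ (s≤s z≤n)) (const λ _ → refl)))))
  where
  κ = ι (suc d)
  coefficient : σ * (0ℚ + - (c * κ) + - (c * κ) + - 0ℚ) ≡ ½ * κ
  coefficient = trans
    (solve 3 (λ σ c κ → σ :* (con 0ℚ :+ :- (c :* κ) :+ :- (c :* κ) :+ :- con 0ℚ)
      := con (- 1ℚ - 1ℚ) :* (σ :* c) :* κ) refl σ c κ)
    (cong (λ z → (- 1ℚ - 1ℚ) * z * κ) σc≡-¼)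

eventually-telescoped : ∀ {d} p → HasTop (suc d) (ι (suc d)) p → HasTop (suc d) 0ℚ (defect (suc d) p) →
  ∀ σ c → σ * c ≡ - ¼ →
  Eventually λ n → 0ℚ <ℚ p (ι n) + c × (∀ m → 0ℚ ≤ℚ
    σ * ((1ℚ - partialSum (tailTerm (suc (suc d)) n) m * (p (ι n) + c)) * (p (ι (n ℕ.+ m)) + c) - (p (ι n) + c)))
eventually-telescoped {d} p p-top defect-top σ c σc≡-¼ =
  let N , p+c>0 = top>0⇒eventually>0 (top-+const c p-top) (ι-suc>0 d)
      M , def>0 = top>0⇒eventually>0 (shifted-defect-top p p-top defect-top σ c σc≡-¼) ½κ>0
  in N ℕ.⊔ M , λ n N⊔M≤n →
    let N≤n = ℕP.m⊔n≤o⇒m≤o N M N⊔M≤n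
        M≤n = ℕP.m⊔n≤o⇒n≤o N M N⊔M≤n
    in p+c>0 n N≤n , telescoped σ (suc d) (λ x → p x + c) n
         (λ i n≤i → p+c>0 i (ℕP.≤-trans N≤n n≤i))
         (λ i n≤i → ℚP.<⇒≤ (def>0 i (ℕP.≤-trans M≤n n≤i)))
  where
  ½κ>0 : 0ℚ <ℚ ½ * ι (suc d)
  ½κ>0 = 0<* (ℚP.positive⁻¹ ½) (ι-suc>0 d)

-- Bounds on the reciprocal of the tail

-- Multiplied by r = 1/S, the gap becomes (r - H) G - r H, and r H ≥ 0.
reciprocal-≥ : ∀ {r S H G} → r * S ≡ 1ℚ → 0ℚ ≤ℚ r → 0ℚ ≤ℚ H → 0ℚ <ℚ G →
  0ℚ ≤ℚ 1ℚ * ((1ℚ - S * H) * G - H) → H ≤ℚ r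
reciprocal-≥ {r} {S} {H} {G} rS≡1 0≤r 0≤H 0<G 0≤gap =
  ℚP.*-cancelʳ-≤-pos G {{positive 0<G}}
    (p+d≡q⇒p≤q (r * (1ℚ * ((1ℚ - S * H) * G - H)) + r * H)
      (trans
        (solve 4 (λ r S H G → H :* G :+ (r :* (con 1ℚ :* ((con 1ℚ :- S :* H) :* G :- H)) :+ r :* H)
          := r :* G :+ H :* G :* (con 1ℚ :- r :* S)) refl r S H G)
        (trans (cong (λ z → r * G + H * G * (1ℚ - z)) rS≡1)
          (solve 2 (λ a b → a :+ b :* (con 1ℚ :- con 1ℚ) := a) refl (r * G) (H * G))))
      (0≤+ (0≤* 0≤r 0≤gap) (0≤* 0≤r 0≤H)))

-- The gap gives r ≤ HG/(G - H) = H + H²/(G - H). The bound on `G` makes G - H positive and at least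
-- 8H², so the excess is at most ⅛.
reciprocal-≤ : ∀ {r S H G} → r * S ≡ 1ℚ → 0ℚ ≤ℚ r → 0ℚ ≤ℚ H → (1ℚ + 1ℚ) * H + H * H * ι 8 <ℚ G →
  0ℚ ≤ℚ - 1ℚ * ((1ℚ - S * H) * G - H) → r ≤ℚ H + ⅛
reciprocal-≤ {r} {S} {H} {G} rS≡1 0≤r 0≤H large 0≤gap =
  ℚP.*-cancelʳ-≤-pos (G - H) {{positive 0<G-H}}
    (p+d≡q⇒p≤q (r * (- 1ℚ * ((1ℚ - S * H) * G - H)) + ⅛ * (H + Q))
      (trans
        (solve 4 (λ r S H G → r :* (G :- H) :+ (r :* (con (- 1ℚ) :* ((con 1ℚ :- S :* H) :* G :- H))
            :+ con ⅛ :* (H :+ (G :- (con (1ℚ + 1ℚ) :* H :+ H :* H :* con (ι 8)))))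
          := (H :+ con ⅛) :* (G :- H) :+ H :* G :* (r :* S :- con 1ℚ)) refl r S H G)
        (trans (cong (λ z → (H + ⅛) * (G - H) + H * G * (z - 1ℚ)) rS≡1)
          (solve 2 (λ a b → a :+ b :* (con 1ℚ :- con 1ℚ) := a) refl ((H + ⅛) * (G - H)) (H * G))))
      (0≤+ (0≤* 0≤r 0≤gap) (0≤* (ℚP.nonNegative⁻¹ ⅛) (0≤+ 0≤H (ℚP.<⇒≤ 0<Q)))))
  where
  Q = G - ((1ℚ + 1ℚ) * H + H * H * ι 8)
  0<Q : 0ℚ <ℚ Q
  0<Q = <⇒0<- large
  0<G-H : 0ℚ <ℚ G - H
  0<G-H = ℚP.<-≤-trans 0<Q (p+d≡q⇒p≤q (H + H * H * ι 8)
    (solve 2 (λ H G → G :- (con (1ℚ + 1ℚ) :* H :+ H :* H :* con (ι 8)) :+ (H :+ H :* H :* con (ι 8))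
      := G :- H) refl H G)
    (0≤+ 0≤H (0≤* (0≤* 0≤H 0≤H) (0≤ι 8))))

-- `recip` drops the terms of x before the index in the positivity witness, hence the shifted index
-- here.
recip-inverse : ∀ x (x>0 : 0ℝ <ℝ x) m →
  recipSeq x x>0 m * seq x (proj₁ (proj₂ (proj₂ x>0)) ℕ.+ m) ≡ 1ℚ × 0ℚ <ℚ recipSeq x x>0 m
recip-inverse x x>0@(δ , δ>0 , M , δ≤x) m = rs≡1 , inverse>0 s>0 rs≡1
  where
  s = seq x (M ℕ.+ m)
  s>0 : 0ℚ <ℚ s
  s>0 = ℚP.<-≤-trans δ>0
    (subst (_≤ℚ s) (ℚP.+-identityˡ δ) (δ≤x (M ℕ.+ m) (ℕP.m≤m+n M m)))
  rs≡1 : recipSeq x x>0 m * s ≡ 1ℚ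
  rs≡1 = ℚP.*-inverseˡ s {{ℚP.pos⇒nonZero s {{positive s>0}}}}

near⇒brackets : ∀ {d} (2≤k : 2 ≤ suc (suc d)) p → HasTop (suc d) (ι (suc d)) p →
  HasTop (suc d) 0ℚ (defect (suc d) p) →
  ∀ f → (∀ x → eval f x ≡ p x + - ½) → Brackets (suc (suc d)) 2≤k f
near⇒brackets {d} 2≤k p p-top defect-top f f≡p-½ =
  let N , below = eventually-telescoped p p-top defect-top 1ℚ (- ¼) refl
      M , above = eventually-telescoped p p-top defect-top (- 1ℚ) ¼ refl
  in N ℕ.⊔ M , λ n N⊔M≤n →
    -- `lower` also uses that p - ¼ is positive at n + m, so `below` is applied there again.
    lower n (below n (ℕP.m⊔n≤o⇒m≤o N M N⊔M≤n)) (λ m → proj₁ (below (n ℕ.+ m)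
      (ℕP.≤-trans (ℕP.m⊔n≤o⇒m≤o N M N⊔M≤n) (ℕP.m≤m+n n m)))) ,
    upper n (above n (ℕP.m⊔n≤o⇒n≤o N M N⊔M≤n))
  where
  k = suc (suc d)

  S : ℕ → ℕ → ℚ
  S n = partialSum (tailTerm k n)

  1/tail : ℕ → ℝ
  1/tail n = recip (tail k 2≤k n) (tail>0 k 2≤k n)

  lower : ∀ n → 0ℚ <ℚ p (ι n) + - ¼ × (∀ m → 0ℚ ≤ℚ
      1ℚ * ((1ℚ - S n m * (p (ι n) + - ¼)) * (p (ι (n ℕ.+ m)) + - ¼) - (p (ι n) + - ¼))) →
    (∀ m → 0ℚ <ℚ p (ι (n ℕ.+ m)) + - ¼) → fromℚ (eval f (ι n)) <ℝ 1/tail n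
  lower n (H>0 , gap) G>0 = ¼ , ℚP.positive⁻¹ ¼ , 0 , λ m _ →
    let rs≡1 , r>0 = recip-inverse (tail k 2≤k n) (tail>0 k 2≤k n) m
    in subst (_≤ℚ seq (1/tail n) m) (sym f+¼)
      -- The witness in `tail>0` starts at index 1, so term m of the reciprocal is 1 / S n (suc m).
      (reciprocal-≥ {S = S n (suc m)} {G = p (ι (n ℕ.+ suc m)) + - ¼}
        rs≡1 (ℚP.<⇒≤ r>0) (ℚP.<⇒≤ H>0) (G>0 (suc m)) (gap (suc m)))
    where
    f+¼ : eval f (ι n) + ¼ ≡ p (ι n) + - ¼
    f+¼ = trans (cong (_+ ¼) (f≡p-½ (ι n))) (ℚP.+-assoc (p (ι n)) (- ½) ¼)

  upper : ∀ n → 0ℚ <ℚ p (ι n) + ¼ × (∀ m → 0ℚ ≤ℚ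
      - 1ℚ * ((1ℚ - S n m * (p (ι n) + ¼)) * (p (ι (n ℕ.+ m)) + ¼) - (p (ι n) + ¼))) →
    1/tail n <ℝ fromℚ (eval f (ι n) + 1ℚ)
  upper n (H>0 , gap) =
    -- Here n, and with it `H`, is fixed, while p(n+m) grows without bound in m.
    let N , large = top>0⇒unbounded (top-+const ¼ p-top) (ι-suc>0 d) ((1ℚ + 1ℚ) * H + H * H * ι 8)
    in ⅛ , ℚP.positive⁻¹ ⅛ , N , λ m N≤m →
      let rs≡1 , r>0 = recip-inverse (tail k 2≤k n) (tail>0 k 2≤k n) m
      in subst (seq (1/tail n) m + ⅛ ≤ℚ_) H+¼
        (ℚP.+-monoˡ-≤ ⅛
          (reciprocal-≤ {S = S n (suc m)} {G = p (ι (n ℕ.+ suc m)) + ¼} rs≡1 (ℚP.<⇒≤ r>0) (ℚP.<⇒≤ H>0)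
            (large (n ℕ.+ suc m) (ℕP.≤-trans N≤m (ℕP.≤-trans (ℕP.n≤1+n m) (ℕP.m≤n+m (suc m) n))))
            (gap (suc m))))
    where
    H = p (ι n) + ¼
    H+¼ : H + ⅛ + ⅛ ≡ eval f (ι n) + 1ℚ
    H+¼ = trans
      (shift (p (ι n)))
      (cong (_+ 1ℚ) (sym (f≡p-½ (ι n))))
      where
      shift : ∀ y → y + ¼ + ⅛ + ⅛ ≡ y + - ½ + 1ℚ
      shift = solve 1 (λ y → y :+ con ¼ :+ con ⅛ :+ con ⅛ := y :+ con (- ½) :+ con 1ℚ) refl

-- Uniqueness

coeff-⊕ : ∀ f g i → coeff (f ⊕ g) i ≡ coeff f i + coeff g i
coeff-⊕ []      g       i       = sym (ℚP.+-identityˡ (coeff g i))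
coeff-⊕ (a ∷ f) []      i       = sym (ℚP.+-identityʳ (coeff (a ∷ f) i))
coeff-⊕ (a ∷ f) (b ∷ g) zero    = refl
coeff-⊕ (a ∷ f) (b ∷ g) (suc i) = coeff-⊕ f g i

eval-⊕ : ∀ f g x → eval (f ⊕ g) x ≡ eval f x + eval g x
eval-⊕ []      g       x = sym (ℚP.+-identityˡ (eval g x))
eval-⊕ (a ∷ f) []      x = sym (ℚP.+-identityʳ (eval (a ∷ f) x))
eval-⊕ (a ∷ f) (b ∷ g) x = trans (cong (λ y → a + b + x * y) (eval-⊕ f g x))
  (solve 5 (λ a b x f g → a :+ b :+ x :* (f :+ g) := a :+ x :* f :+ (b :+ x :* g)) refl
    a b x (eval f x) (eval g x))

⊝_ : Poly → Poly
⊝_ = map (-_)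

coeff-⊝ : ∀ f i → coeff (⊝ f) i ≡ - coeff f i
coeff-⊝ []      _       = refl
coeff-⊝ (a ∷ f) zero    = refl
coeff-⊝ (a ∷ f) (suc i) = coeff-⊝ f i

eval-⊝ : ∀ f x → eval (⊝ f) x ≡ - eval f x
eval-⊝ []      _ = refl
eval-⊝ (a ∷ f) x = trans (cong (λ y → - a + x * y) (eval-⊝ f x))
  (solve 3 (λ a x y → :- a :+ x :* :- y := :- (a :+ x :* y)) refl a x (eval f x))

fromℚ-<ℝ-<ℝ : ∀ {p q x} → fromℚ p <ℝ x → x <ℝ fromℚ q → p <ℚ q
fromℚ-<ℝ-<ℝ {p} {q} {x} (ε , ε>0 , N , p+ε≤x) (η , η>0 , M , x+η≤q) =
  ℚP.<-≤-trans (p+d≡q⇒p<q ε refl ε>0)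
    (ℚP.≤-trans (p+ε≤x m (ℕP.m≤m⊔n N M))
      (ℚP.≤-trans (p+d≡q⇒p≤q η refl (ℚP.<⇒≤ η>0)) (x+η≤q m (ℕP.m≤n⊔m N M))))
  where m = N ℕ.⊔ M

-- The same real 1/tail lies above f(n) and below g(n) + 1.
brackets⇒eventually<+1 : ∀ k (2≤k : 2 ≤ k) f g → Brackets k 2≤k f → Brackets k 2≤k g →
  Eventually λ n → eval f (ι n) <ℚ eval g (ι n) + 1ℚ
brackets⇒eventually<+1 k 2≤k f g (N , f<) (M , <g+1) = N ℕ.⊔ M , λ n N⊔M≤n →
  fromℚ-<ℝ-<ℝ {x = recip (tail k 2≤k n) (tail>0 k 2≤k n)}
    (proj₁ (f< n (ℕP.m⊔n≤o⇒m≤o N M N⊔M≤n))) (proj₂ (<g+1 n (ℕP.m⊔n≤o⇒n≤o N M N⊔M≤n)))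

<+1⇒-<1 : ∀ {p q} → p <ℚ q + 1ℚ → p - q <ℚ 1ℚ
<+1⇒-<1 {p} {q} p<q+1 = subst (p - q <ℚ_)
  (solve 1 (λ q → q :+ con 1ℚ :- q := con 1ℚ) refl q) (ℚP.+-monoˡ-< (- q) p<q+1)

brackets-unique : ∀ k (2≤k : 2 ≤ k) f g → Brackets k 2≤k f → Brackets k 2≤k g →
  ∃[ c ] (f ≋ g ⊕ constant c)
brackets-unique k 2≤k f g f-brackets g-brackets = coeff f 0 - coeff g 0 , λ i →
  trans (agree i) (sym (coeff-⊕ g (constant (coeff f 0 - coeff g 0)) i))
  where
  eval-diff : ∀ x → eval (f ⊕ ⊝ g) x ≡ eval f x - eval g x
  eval-diff x = trans (eval-⊕ f (⊝ g) x) (cong (λ y → eval f x + y) (eval-⊝ g x))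

  above : Eventually λ n → eval (f ⊕ ⊝ g) (ι n) <ℚ 1ℚ
  above =
    let N , f<g+1 = brackets⇒eventually<+1 k 2≤k f g f-brackets g-brackets
    in N , λ n N≤n → subst (_<ℚ 1ℚ) (sym (eval-diff (ι n))) (<+1⇒-<1 (f<g+1 n N≤n))

  below : Eventually λ n → - eval (f ⊕ ⊝ g) (ι n) <ℚ 1ℚ
  below =
    let N , g<f+1 = brackets⇒eventually<+1 k 2≤k g f g-brackets f-brackets
    in N , λ n N≤n → subst (_<ℚ 1ℚ)
      (trans (flip (eval f (ι n)) (eval g (ι n))) (cong -_ (sym (eval-diff (ι n)))))
      (<+1⇒-<1 (g<f+1 n N≤n))
    where
    flip : ∀ p q → q - p ≡ - (p - q)
    flip = solve 2 (λ p q → q :- p := :- (p :- q)) refl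

  p≡q+[p-q] : ∀ p q → p ≡ q + (p - q)
  p≡q+[p-q] = solve 2 (λ p q → p := q :+ (p :- q)) refl

  agree : ∀ i → coeff f i ≡ coeff g i + coeff (constant (coeff f 0 - coeff g 0)) i
  agree zero    = p≡q+[p-q] (coeff f 0) (coeff g 0)
  agree (suc i) = trans (p≡q+[p-q] (coeff f (suc i)) (coeff g (suc i)))
    (cong (λ y → coeff g (suc i) + y)
      (trans (sym (trans (coeff-⊕ f (⊝ g) (suc i)) (cong (λ y → coeff f (suc i) + y) (coeff-⊝ g (suc i)))))
        (bounded⇒constant (f ⊕ ⊝ g) above below i)))

-- Existence and conclusion

brackets-exists : ∀ k (2≤k : 2 ≤ k) → ∃[ f ] (HasDegree f (k ∸ 1) × Brackets k 2≤k f)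
brackets-exists (suc (suc d)) 2≤k =
  -- At j = 0 every coefficient has been chosen, the constant one included, and the defect has
  -- degree below K = k - 1.
  let p , p-top , defect-top = nearSolution (suc d) 0 refl
      f-top = top-+const (- ½) p-top
  in toPoly f-top ,
     ((λ c≡0 → ℚP.<⇒≢ (ι-suc>0 d) (trans (sym c≡0) (coeff-toPoly f-top))) , coeff-toPoly-> f-top) ,
     near⇒brackets 2≤k p p-top
       (subst (λ n → HasTop n 0ℚ (defect (suc d) p)) (ℕP.+-identityʳ (suc d)) defect-top)
       (toPoly f-top) (eval-toPoly f-top)
brackets-exists (suc zero) (s≤s ())

theorem1p1 : (k : ℕ) (2≤k : 2 ≤ k) →
    (∃[ f ] (HasDegree f (k ∸ 1) × Brackets k 2≤k f))
    × (∀ f g →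
    HasDegree f (k ∸ 1) → Brackets k 2≤k f →
    HasDegree g (k ∸ 1) → Brackets k 2≤k g →
    ∃[ c ] (f ≋ g ⊕ constant c))
theorem1p1 k 2≤k =
  brackets-exists k 2≤k ,
  λ f g _ f-brackets _ g-brackets → brackets-unique k 2≤k f g f-brackets g-brackets
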